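{- Consider a round of Algorithm SE-A with $z=2$ and current simple graph $\mathcal{G}(V,E)$ in which every vertex has degree at least $2$. For any two distinct vertices $u,w\in V$, the joint inclusion probability $\pi_{uw}$, i.e. the probability that the pair selected in this round is $\{u,w\}$, is bounded below by $$\pi_{uw}\ \ge\ \frac{2}{3|E|^2}.$$
   Context: **Random systematic sampling (RSS).** Input: distinct elements $x_1,\dots,x_N$ with positive integer frequencies $d_1,\dots,d_N$, $s=\sum_i d_i$, and a sample size $m$ dividing $s$ (here always $d_i\le s/m$). Permute the elements (together with their frequencies) uniformly at random; independently draw $r$ uniformly from $[0,s/m)$; with $D_i=d_1+\dots+d_i$ (in the permuted order, $D_0=0$), output for each $j=0,1,\dots,m-1$ the element $x_i$ for which $D_{i-1}\le r+j\,s/m<D_i$. **Round of Algorithm SE-A with $z=2$.** Select two edges $e_1,e_2$ of $E$ independently and uniformly at random (with replacement). Form the bag of endpoints of $e_1,e_2$, each vertex having frequency equal to the number of indices $i\in\{1,2\}$ with the vertex in $e_i$ (total frequency $4$), and apply RSS with sample size $m=2$. The output is the selected pair (a new vertex is then joined to both of its elements). -}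

module Defs where

open import Level using (0ℓ)
open import Data.Nat.Base using (ℕ; zero; suc; _+_; _*_; _^_; _/_; _≤_; _<_; NonZero; s≤s)
open import Data.Nat.Properties using (_≤?_; _<?_; m*n≢0; m^n≢0)
open import Data.Nat.ListAction using (sum)
open import Data.Integer.Base using (+_)
open import Data.Rational.Base as ℚ using (ℚ; 0ℚ; 1ℚ)
open import Data.Fin.Base as Fin using (Fin)
import Data.Fin.Properties as Fin
open import Data.List.Base
  using (List; []; _∷_; map; concatMap; foldr; filter; length; mapMaybe; upTo; allFin;
         cartesianProduct; deduplicate)
open import Data.List.Membership.Propositional using (_∈_)
open import Data.List.Membership.Propositional.Properties
  using (∈-filter⁺; ∈-filter⁻; ∈-cartesianProduct⁺; ∈-allFin)
open import Data.List.Relation.Unary.Any using (here)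
open import Data.Maybe.Base using (Maybe; just; nothing)
open import Data.Product.Base using (_×_; _,_; proj₁; proj₂; map₂; ∃)
open import Data.Sum.Base using (_⊎_)
open import Data.Bool.Base using (if_then_else_)
open import Data.Empty using (⊥-elim)
open import Relation.Binary.Core using (Rel)
open import Relation.Binary.Definitions
  using (Decidable; Symmetric; Irreflexive; tri<; tri≈; tri>)
open import Relation.Binary.PropositionalEquality using (_≡_; refl)
open import Relation.Nullary.Decidable using (does; _×-dec_; _⊎-dec_)
import Relation.Unary as U

private
  variable
    A B : Set
    n : ℕ

------------------------------------------------------------------------
-- Finitely supported distributions, as lists of weighted outcomes.
-- The same outcome may be listed several times; its weights then add up.

Dist : Set → Set
Dist A = List (A × ℚ)

return : A → Dist A
return x = (x , 1ℚ) ∷ []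

infixl 1 _>>=_

_>>=_ : Dist A → (A → Dist B) → Dist B
d >>= f = concatMap (λ (x , p) → map (map₂ (p ℚ.*_)) (f x)) d

-- There is no uniform distribution on the empty list; the first clause only
-- makes the function total.
uniform : List A → Dist A
uniform []           = []
uniform xs@(_ ∷ xs′) = map (_, (+ 1 ℚ./ suc (length xs′))) xs

Pr : {P : U.Pred A 0ℓ} → U.Decidable P → Dist A → ℚ
Pr P? d = foldr ℚ._+_ 0ℚ (map proj₂ (filter (λ (x , _) → P? x) d))

------------------------------------------------------------------------
-- Random systematic sampling

insertions : A → List A → List (List A)
insertions x []       = (x ∷ []) ∷ []
insertions x (y ∷ ys) = (x ∷ y ∷ ys) ∷ map (y ∷_) (insertions x ys)

permutations : List A → List (List A)
permutations []       = [] ∷ []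
permutations (x ∷ xs) = concatMap (insertions x) (permutations xs)

-- Elements paired with their frequencies.
Bag : Set → Set
Bag A = List (A × ℕ)

total : Bag A → ℕ
total xs = sum (map proj₂ xs)

-- locate D xs t is the element x_i of xs with D_{i-1} ≤ t < D_i, where the
-- partial sums of the frequencies start from D_0 = D.
locate : ℕ → Bag A → ℕ → Maybe A
locate D []             t = nothing
locate D ((x , d) ∷ xs) t =
  if does (D ≤? t ×-dec t <? D + d) then just x else locate (D + d) xs t

-- The step is s/m; m is meant to divide s.  For r < s/m every position lies
-- below s, so exactly m elements are output.
systematicSample : (m : ℕ) → .{{NonZero m}} → Bag A → ℕ → List A
systematicSample m xs r = mapMaybe (λ j → locate 0 xs (r + j * (total xs / m))) (upTo m)

-- The offset r is drawn uniformly from the integers 0, …, s/m − 1.  Since s/m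
-- and all the D_i are integers, the sample for a real offset r ∈ [0, s/m) is
-- that for ⌊r⌋, and ⌊r⌋ is uniform on these integers when r is uniform.
rss : (m : ℕ) → .{{NonZero m}} → Bag A → Dist (List A)
rss m xs =
  uniform (permutations xs)     >>= λ σ →
  uniform (upTo (total xs / m)) >>= λ r →
  return (systematicSample m σ r)

------------------------------------------------------------------------
-- Finite simple graphs

record SimpleGraph (n : ℕ) : Set₁ where
  infix 4 _~_ _~?_
  field
    _~_    : Rel (Fin n) 0ℓ
    _~?_   : Decidable _~_
    sym    : Symmetric _~_
    irrefl : Irreflexive _≡_ _~_

  -- Each edge is listed once, with its smaller endpoint first.
  edges : List (Fin n × Fin n)
  edges = filter (λ (i , j) → i Fin.<? j ×-dec i ~? j)
                 (cartesianProduct (allFin n) (allFin n))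

  ∣E∣ : ℕ
  ∣E∣ = length edges

  degree : Fin n → ℕ
  degree v = length (filter (v ~?_) (allFin n))

------------------------------------------------------------------------
-- A round of the algorithm with z = 2

_Endpoint_ : Fin n → Fin n × Fin n → Set
v Endpoint (a , b) = v ≡ a ⊎ v ≡ b

endpoint? : (v : Fin n) → U.Decidable (v Endpoint_)
endpoint? v (a , b) = v Fin.≟ a ⊎-dec v Fin.≟ b

endpointBag : List (Fin n × Fin n) → Bag (Fin n)
endpointBag es = map (λ v → v , length (filter (endpoint? v) es))
                     (deduplicate Fin._≟_ (concatMap (λ (a , b) → a ∷ b ∷ []) es))

selectPair : SimpleGraph n → Dist (List (Fin n))
selectPair G =
  uniform edges >>= λ e₁ →
  uniform edges >>= λ e₂ →
  rss 2 (endpointBag (e₁ ∷ e₂ ∷ []))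
  where open SimpleGraph G

-- The sample is an ordered list, so {u , w} can be output in either order.
IsPair : A → A → List A → Set
IsPair u w s = s ≡ u ∷ w ∷ [] ⊎ s ≡ w ∷ u ∷ []

isPair? : (u w : Fin n) → U.Decidable (IsPair u w)
isPair? u w s = s ≟ˡ (u ∷ w ∷ []) ⊎-dec s ≟ˡ (w ∷ u ∷ [])
  where open import Data.List.Properties using (≡-dec)
        _≟ˡ_ = ≡-dec Fin._≟_

-- Joint inclusion probability
π : SimpleGraph n → Fin n → Fin n → ℚ
π G u w = Pr (isPair? u w) (selectPair G)

------------------------------------------------------------------------
-- A graph of minimum degree at least 2 with a vertex has an edge, so that
-- 3∣E∣² can be used as a denominator.

module _ (G : SimpleGraph n) where
  open SimpleGraph G

  MinDegree≥2 : Set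
  MinDegree≥2 = ∀ v → 2 ≤ degree v

  private
    someElement : (xs : List A) → 2 ≤ length xs → ∃ (_∈ xs)
    someElement (x ∷ _) _ = x , here refl

    nonEmpty : {x : A} {xs : List A} → x ∈ xs → NonZero (length xs)
    nonEmpty {xs = _ ∷ _} _ = _

    edge∈ : ∀ {i j} → i Fin.< j → i ~ j → (i , j) ∈ edges
    edge∈ {i} {j} i<j i~j =
      ∈-filter⁺ (λ (i , j) → i Fin.<? j ×-dec i ~? j)
                (∈-cartesianProduct⁺ (∈-allFin i) (∈-allFin j)) (i<j , i~j)

  ∣E∣≢0 : MinDegree≥2 → Fin n → NonZero ∣E∣
  ∣E∣≢0 δ≥2 v with someElement (filter (v ~?_) (allFin n)) (δ≥2 v)
  ... | w , w∈ with proj₂ (∈-filter⁻ (v ~?_) {xs = allFin n} w∈) | Fin.<-cmp v w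
  ... | v~w | tri< v<w _ _ = nonEmpty (edge∈ v<w v~w)
  ... | v~w | tri≈ _ v≡w _ = ⊥-elim (irrefl v≡w v~w)
  ... | v~w | tri> _ _ w<v = nonEmpty (edge∈ w<v (sym v~w))

  3∣E∣²≢0 : MinDegree≥2 → Fin n → NonZero (3 * ∣E∣ ^ 2)
  3∣E∣²≢0 δ≥2 v = m*n≢0 3 (∣E∣ ^ 2) {{_}} {{m^n≢0 ∣E∣ 2 {{∣E∣≢0 δ≥2 v}}}}

{-# OPTIONS --safe #-}
-- If u and w are adjacent, drawing the edge uw twice selects {u , w} with
-- certainty.  Otherwise u has neighbours c ≠ c′ and w has neighbours d ≠ d′,
-- which can be numbered so that c ≠ d and c′ ≠ d′.  The four edges uc, uc′, wd
-- and wd′ are then distinct, and each of the four ordered draws (uc , wd),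
-- (uc′ , wd′), (wd , uc), (wd′ , uc′) consists of disjoint edges and so selects
-- {u , w} with probability 1/6.
module Submission where

open import Defs
open import Level using (0ℓ)
open import Data.Nat.Base as ℕ using (ℕ; suc; _*_; _^_; s≤s)
open import Data.Nat.Properties using (_≤?_; _<?_)
open import Data.Nat.ListAction using (sum)
import Data.Nat.Solver
open import Data.Integer.Base as ℤ using (+_)
import Data.Integer.Properties as ℤ
open import Data.Bool.Base using (true; false)
open import Data.Fin.Base as Fin using (Fin)
open import Data.Fin.Patterns using (0F; 1F; 2F; 3F)
import Data.Fin.Properties as Fin
open import Data.List.Base
  using (List; []; _∷_; _++_; map; concatMap; foldr; filter; length; upTo; allFin;
         deduplicate)
open import Data.List.Properties
  using (map-cong; map-∘; length-map; concatMap-cong; concatMap-map; map-concatMap;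
         mapMaybe-cong; map-mapMaybe; filter-≐; map-injective)
open import Data.List.Membership.Propositional using (_∈_)
open import Data.List.Membership.Propositional.Properties
  using (∈-filter⁺; ∈-filter⁻; ∈-cartesianProduct⁺; ∈-allFin; ∈-∃++; ∈-++⁺ˡ; ∈-++⁺ʳ; ∈-++⁻)
open import Data.List.Relation.Binary.Subset.Propositional using (_⊆_)
open import Data.List.Relation.Unary.All as All using (All; []; _∷_)
import Data.List.Relation.Unary.All.Properties as All
open import Data.List.Relation.Unary.AllPairs using ([]; _∷_)
open import Data.List.Relation.Unary.Any using (here; there)
open import Data.List.Relation.Unary.Unique.Propositional using (Unique)
import Data.List.Relation.Unary.Unique.Propositional.Properties as Unique
import Data.Maybe.Base as Maybe
open import Data.Product.Base as × using (_×_; _,_; proj₁; proj₂; map₁; map₂; ∃; ∃₂)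
open import Data.Rational.Base as ℚ using (ℚ; 0ℚ; 1ℚ; NonNegative; _/_; _≥_; fromℚᵘ)
import Data.Rational.Properties as ℚ
open import Data.Rational.Unnormalised.Base as ℚᵘ using (mkℚᵘ; *≡*)
import Data.Rational.Unnormalised.Properties as ℚᵘ
open import Data.Sum.Base as ⊎ using (_⊎_; inj₁; inj₂; [_,_]′)
open import Data.Vec.Base as Vec using ([]; _∷_)
open import Data.Vec.Relation.Unary.All using ([]; _∷_)
open import Data.Vec.Relation.Unary.AllPairs using ([]; _∷_)
import Data.Vec.Relation.Unary.Unique.Propositional as Vec
import Data.Vec.Relation.Unary.Unique.Propositional.Properties as Vec
open import Function.Base using (_∘_)
open import Function.Definitions using (Injective)
open import Relation.Binary.Definitions using (tri<; tri≈; tri>)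
open import Relation.Binary.PropositionalEquality
open import Relation.Nullary using (¬_; yes; no; contradiction)
open import Relation.Nullary.Decidable using (does; toSum; _×-dec_; ¬?)
import Relation.Unary as U

private
  variable
    A B C : Set
    k n   : ℕ

-- Arithmetic of fractions

-- Matching both denominators as successors turns each quotient into `fromℚᵘ` of an unnormalised
-- fraction, where equality is cross multiplication.
/-cong-≃ : ∀ a b c d .{{_ : ℕ.NonZero b}} .{{_ : ℕ.NonZero d}} →
           a * d ≡ c * b → + a / b ≡ + c / d
/-cong-≃ a b@(suc b-1) c d@(suc d-1) eq = ℚ.fromℚᵘ-cong {mkℚᵘ (+ a) b-1} {mkℚᵘ (+ c) d-1}
  (*≡* (trans (sym (ℤ.pos-* a d)) (trans (cong +_ eq) (ℤ.pos-* c b))))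

-- Checked after applying the injective `toℚᵘ`, which is multiplicative and inverts `fromℚᵘ` up to
-- `≃`. It allows products to be computed before normalisation.
fromℚᵘ-homo-* : ∀ p q → fromℚᵘ (p ℚᵘ.* q) ≡ fromℚᵘ p ℚ.* fromℚᵘ q
fromℚᵘ-homo-* p q = ℚ.toℚᵘ-injective (begin-equality
  ℚ.toℚᵘ (fromℚᵘ (p ℚᵘ.* q))                     ≃⟨ ℚ.toℚᵘ-fromℚᵘ (p ℚᵘ.* q) ⟩
  p ℚᵘ.* q                                       ≃⟨ ℚᵘ.*-cong (ℚ.toℚᵘ-fromℚᵘ p) (ℚ.toℚᵘ-fromℚᵘ q) ⟨
  ℚ.toℚᵘ (fromℚᵘ p) ℚᵘ.* ℚ.toℚᵘ (fromℚᵘ q)       ≃⟨ ℚ.toℚᵘ-homo-* (fromℚᵘ p) (fromℚᵘ q) ⟨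
  ℚ.toℚᵘ (fromℚᵘ p ℚ.* fromℚᵘ q)                 ∎)
  where open ℚᵘ.≤-Reasoning

fromℚᵘ-homo-+ : ∀ p q → fromℚᵘ (p ℚᵘ.+ q) ≡ fromℚᵘ p ℚ.+ fromℚᵘ q
fromℚᵘ-homo-+ p q = ℚ.toℚᵘ-injective (begin-equality
  ℚ.toℚᵘ (fromℚᵘ (p ℚᵘ.+ q))                     ≃⟨ ℚ.toℚᵘ-fromℚᵘ (p ℚᵘ.+ q) ⟩
  p ℚᵘ.+ q                                       ≃⟨ ℚᵘ.+-cong (ℚ.toℚᵘ-fromℚᵘ p) (ℚ.toℚᵘ-fromℚᵘ q) ⟨
  ℚ.toℚᵘ (fromℚᵘ p) ℚᵘ.+ ℚ.toℚᵘ (fromℚᵘ q)       ≃⟨ ℚ.toℚᵘ-homo-+ (fromℚᵘ p) (fromℚᵘ q) ⟨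
  ℚ.toℚᵘ (fromℚᵘ p ℚ.+ fromℚᵘ q)                 ∎)
  where open ℚᵘ.≤-Reasoning

-- Splits one summand `1 / b` off a count of favourable draws; this is the induction step of
-- `sum-≥`.
suc/ : ∀ a b .{{_ : ℕ.NonZero b}} → + suc a / b ≡ + 1 / b ℚ.+ + a / b
suc/ a b@(suc b-1) = trans
  (ℚ.fromℚᵘ-cong {mkℚᵘ (+ suc a) b-1} {mkℚᵘ (+ 1) b-1 ℚᵘ.+ mkℚᵘ (+ a) b-1} (*≡* eq))
  (fromℚᵘ-homo-+ (mkℚᵘ (+ 1) b-1) (mkℚᵘ (+ a) b-1))
  where
  open ≡-Reasoning
  eq : + suc a ℤ.* + (b * b) ≡ (+ 1 ℤ.* + b ℤ.+ + a ℤ.* + b) ℤ.* + b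
  eq = begin
    + suc a ℤ.* + (b * b)                       ≡⟨ cong (+ suc a ℤ.*_) (ℤ.pos-* b b) ⟩
    + suc a ℤ.* (+ b ℤ.* + b)                   ≡⟨ ℤ.*-assoc (+ suc a) (+ b) (+ b) ⟨
    + suc a ℤ.* + b ℤ.* + b                     ≡⟨ cong (ℤ._* + b) (ℤ.*-distribʳ-+ (+ b) (+ 1) (+ a)) ⟩
    (+ 1 ℤ.* + b ℤ.+ + a ℤ.* + b) ℤ.* + b       ∎

/-* : ∀ a b c d .{{_ : ℕ.NonZero b}} .{{_ : ℕ.NonZero d}} .{{_ : ℕ.NonZero (b * d)}} →
      (+ a / b) ℚ.* (+ c / d) ≡ + (a * c) / (b * d)
/-* a b@(suc b-1) c d@(suc d-1) = trans
  (sym (fromℚᵘ-homo-* (mkℚᵘ (+ a) b-1) (mkℚᵘ (+ c) d-1)))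
  (cong (_/ (b * d)) (sym (ℤ.pos-* a c)))

-- Sums and probabilities

sumℚ : List ℚ → ℚ
sumℚ = foldr ℚ._+_ 0ℚ

sumℚ-insert : ∀ (h : A → ℚ) xs y zs →
              sumℚ (map h (xs ++ y ∷ zs)) ≡ h y ℚ.+ sumℚ (map h (xs ++ zs))
sumℚ-insert h []       y zs = refl
sumℚ-insert h (x ∷ xs) y zs = begin
  h x ℚ.+ sumℚ (map h (xs ++ y ∷ zs))  ≡⟨ cong (h x ℚ.+_) (sumℚ-insert h xs y zs) ⟩
  h x ℚ.+ (h y ℚ.+ s)                  ≡⟨ ℚ.+-assoc (h x) (h y) s ⟨
  h x ℚ.+ h y ℚ.+ s                    ≡⟨ cong (ℚ._+ s) (ℚ.+-comm (h x) (h y)) ⟩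
  h y ℚ.+ h x ℚ.+ s                    ≡⟨ ℚ.+-assoc (h y) (h x) s ⟩
  h y ℚ.+ (h x ℚ.+ s)                  ∎
  where
  open ≡-Reasoning
  s = sumℚ (map h (xs ++ zs))

sumℚ-nonNeg : ∀ (h : A → ℚ) → (∀ x → NonNegative (h x)) → ∀ xs → 0ℚ ℚ.≤ sumℚ (map h xs)
sumℚ-nonNeg h h≥0 []       = ℚ.≤-refl
sumℚ-nonNeg h h≥0 (x ∷ xs) =
  ℚ.+-mono-≤ (ℚ.nonNegative⁻¹ (h x) {{h≥0 x}}) (sumℚ-nonNeg h h≥0 xs)

-- By induction on `ys`: find the head in `xs`, delete that occurrence, and continue with the rest.
-- Without uniqueness `ys` could count an entry of `xs` several times.
sumℚ-⊆ : ∀ (h : A → ℚ) → (∀ x → NonNegative (h x)) →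
         ∀ {xs ys} → Unique ys → ys ⊆ xs → sumℚ (map h ys) ℚ.≤ sumℚ (map h xs)
sumℚ-⊆ h h≥0 {xs} {[]}     _         _     = sumℚ-nonNeg h h≥0 xs
sumℚ-⊆ h h≥0 {xs} {y ∷ ys} (y∉ ∷ u) y∷ys⊆ with ∈-∃++ (y∷ys⊆ (here refl))
... | as , bs , refl = ℚ.≤-trans
  (ℚ.+-monoʳ-≤ (h y) (sumℚ-⊆ h h≥0 u ys⊆))
  (ℚ.≤-reflexive (sym (sumℚ-insert h as y bs)))
  where
  ys⊆ : ys ⊆ as ++ bs
  ys⊆ z∈ with ∈-++⁻ as (y∷ys⊆ (there z∈))
  ... | inj₁ z∈as         = ∈-++⁺ˡ z∈as
  -- Here the entry is the deleted one itself, which uniqueness keeps from recurring in the tail of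
  -- `ys`.
  ... | inj₂ (here refl)  = contradiction refl (All.lookup y∉ z∈)
  ... | inj₂ (there z∈bs) = ∈-++⁺ʳ as z∈bs

module _ {P : U.Pred A 0ℓ} (P? : U.Decidable P) where

  Pr-++ : ∀ d e → Pr P? (d ++ e) ≡ Pr P? d ℚ.+ Pr P? e
  Pr-++ []            e = sym (ℚ.+-identityˡ _)
  Pr-++ ((x , p) ∷ d) e with does (P? x)
  ... | false = Pr-++ d e
  ... | true  = trans (cong (p ℚ.+_) (Pr-++ d e)) (sym (ℚ.+-assoc p _ _))

  Pr-scale : ∀ p d → Pr P? (map (map₂ (p ℚ.*_)) d) ≡ p ℚ.* Pr P? d
  Pr-scale p []            = sym (ℚ.*-zeroʳ p)
  Pr-scale p ((x , q) ∷ d) with does (P? x)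
  ... | false = Pr-scale p d
  ... | true  = trans (cong (p ℚ.* q ℚ.+_) (Pr-scale p d)) (sym (ℚ.*-distribˡ-+ p q _))

  -- The law of total probability, conditioning on the outcome of `d`.
  Pr->>= : ∀ (d : Dist B) (f : B → Dist A) →
           Pr P? (d >>= f) ≡ sumℚ (map (λ (x , p) → p ℚ.* Pr P? (f x)) d)
  Pr->>= []            f = refl
  Pr->>= ((x , p) ∷ d) f =
    trans (Pr-++ (map (map₂ (p ℚ.*_)) (f x)) (d >>= f)) (cong₂ ℚ._+_ (Pr-scale p (f x)) (Pr->>= d f))

  Pr-map : ∀ (g : B → A) d → Pr P? (map (map₁ g) d) ≡ Pr (λ x → P? (g x)) d
  Pr-map g []            = refl
  Pr-map g ((x , p) ∷ d) with does (P? (g x))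
  ... | false = Pr-map g d
  ... | true  = cong (p ℚ.+_) (Pr-map g d)

  Pr-cong : ∀ {Q : U.Pred A 0ℓ} (Q? : U.Decidable Q) → P U.≐ Q → ∀ d → Pr P? d ≡ Pr Q? d
  Pr-cong Q? (P⊆Q , Q⊆P) d = cong (sumℚ ∘ map proj₂) (filter-≐ _ _ (P⊆Q , Q⊆P) d)

  Pr-nonNeg : ∀ {d} → All (NonNegative ∘ proj₂) d → NonNegative (Pr P? d)
  Pr-nonNeg {[]}          []       = _
  Pr-nonNeg {(x , p) ∷ d} (p≥0 ∷ d≥0) with does (P? x)
  ... | false = Pr-nonNeg d≥0
  ... | true  = ℚ.nonNeg+nonNeg⇒nonNeg p {{p≥0}} _ {{Pr-nonNeg d≥0}}

  Pr-uniform->>= : ∀ (f : B → Dist A) xs .{{_ : ℕ.NonZero (length xs)}} →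
    Pr P? (uniform xs >>= f) ≡ sumℚ (map (λ x → + 1 / length xs ℚ.* Pr P? (f x)) xs)
  Pr-uniform->>= f xs@(_ ∷ _) = trans (Pr->>= (uniform xs) f)
    (cong sumℚ (sym (map-∘ {g = λ (x , p) → p ℚ.* Pr P? (f x)} {f = _, (+ 1 / length xs)} xs)))

>>=-nonNeg : ∀ {d : Dist A} {f : A → Dist B} → All (NonNegative ∘ proj₂) d →
             (∀ x → All (NonNegative ∘ proj₂) (f x)) → All (NonNegative ∘ proj₂) (d >>= f)
>>=-nonNeg                     []          f≥0 = []
>>=-nonNeg {d = (x , p) ∷ d} (p≥0 ∷ d≥0) f≥0 = All.++⁺
  (All.map⁺ (All.map (λ q≥0 → ℚ.nonNeg*nonNeg⇒nonNeg p {{p≥0}} _ {{q≥0}}) (f≥0 x)))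
  (>>=-nonNeg d≥0 f≥0)

uniform-nonNeg : ∀ (xs : List A) → All (NonNegative ∘ proj₂) (uniform xs)
uniform-nonNeg []             = []
uniform-nonNeg xs@(_ ∷ xs′) =
  All.map⁺ (All.universal (λ _ → ℚ.normalize-nonNeg 1 (suc (length xs′))) xs)

rss-nonNeg : ∀ m .{{_ : ℕ.NonZero m}} (xs : Bag A) → All (NonNegative ∘ proj₂) (rss m xs)
rss-nonNeg m xs = >>=-nonNeg (uniform-nonNeg (permutations xs)) λ _ →
                  >>=-nonNeg (uniform-nonNeg (upTo (total xs ℕ./ m))) λ _ → _ ∷ []

module _ {P : U.Pred A 0ℓ} (P? : U.Decidable P) {f : B → Dist A}
         (f≥0 : ∀ x → All (NonNegative ∘ proj₂) (f x)) where

  -- `ys` collects favourable draws: each has weight `1 / length xs` and succeeds with probability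
  -- at least `q`, while all other draws contribute nonnegative amounts and are dropped.
  Pr-uniform-≥ : ∀ {xs ys q} .{{_ : ℕ.NonZero (length xs)}} → Unique ys → ys ⊆ xs →
                 All (λ y → q ℚ.≤ Pr P? (f y)) ys →
                 (+ length ys / length xs) ℚ.* q ℚ.≤ Pr P? (uniform xs >>= f)
  Pr-uniform-≥ {xs} {ys} {q} u ys⊆ q≤ = begin
    (+ length ys / length xs) ℚ.* q  ≤⟨ sum-≥ q≤ ⟩
    sumℚ (map h ys)                  ≤⟨ sumℚ-⊆ h h≥0 u ys⊆ ⟩
    sumℚ (map h xs)                  ≡⟨ Pr-uniform->>= P? f xs ⟨
    Pr P? (uniform xs >>= f)         ∎
    where
    open ℚ.≤-Reasoning
    w = + 1 / length xs
    h = λ x → w ℚ.* Pr P? (f x)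

    w≥0 : NonNegative w
    w≥0 = ℚ.normalize-nonNeg 1 (length xs)

    h≥0 : ∀ x → NonNegative (h x)
    h≥0 x = ℚ.nonNeg*nonNeg⇒nonNeg w {{w≥0}} _ {{Pr-nonNeg P? (f≥0 x)}}

    sum-≥ : ∀ {ys} → All (λ y → q ℚ.≤ Pr P? (f y)) ys →
            (+ length ys / length xs) ℚ.* q ℚ.≤ sumℚ (map h ys)
    sum-≥ [] = ℚ.≤-reflexive
      (trans (cong (ℚ._* q) (/-cong-≃ 0 (length xs) 0 1 refl)) (ℚ.*-zeroˡ q))
    sum-≥ {y ∷ ys} (q≤ ∷ qs≤) = begin
      (+ suc (length ys) / length xs) ℚ.* q              ≡⟨ cong (ℚ._* q) (suc/ (length ys) (length xs)) ⟩
      (w ℚ.+ (+ length ys / length xs)) ℚ.* q            ≡⟨ ℚ.*-distribʳ-+ q w _ ⟩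
      w ℚ.* q ℚ.+ (+ length ys / length xs) ℚ.* q        ≤⟨ ℚ.+-mono-≤ (ℚ.*-monoˡ-≤-nonNeg w {{w≥0}} q≤) (sum-≥ qs≤) ⟩
      h y ℚ.+ sumℚ (map h ys)                            ∎

-- Naturality of sampling

>>=-mapˡ : ∀ (g : B → Dist C) (f : A → B) d → (map (map₁ f) d >>= g) ≡ (d >>= g ∘ f)
>>=-mapˡ g f = concatMap-map _ (map₁ f)

map->>= : ∀ (g : B → C) (f : A → Dist B) d → map (map₁ g) (d >>= f) ≡ (d >>= map (map₁ g) ∘ f)
map->>= g f d = trans (map-concatMap (map₁ g) _ d) (concatMap-cong (λ (x , p) → trans
  (sym (map-∘ {g = map₁ g} {f = map₂ (p ℚ.*_)} (f x)))
  (map-∘ {g = map₂ (p ℚ.*_)} {f = map₁ g} (f x))) d)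

>>=-congʳ : ∀ {f g : A → Dist B} → f ≗ g → ∀ d → (d >>= f) ≡ (d >>= g)
>>=-congʳ f≗g = concatMap-cong (λ (x , p) → cong (map (map₂ (p ℚ.*_))) (f≗g x))

module _ (f : A → B) where

  uniform-map : ∀ xs → uniform (map f xs) ≡ map (map₁ f) (uniform xs)
  uniform-map []         = refl
  uniform-map xs@(_ ∷ xs′) rewrite length-map f xs′ =
    trans (sym (map-∘ {g = _, (+ 1 / length xs)} {f = f} xs))
          (map-∘ {g = map₁ f} {f = _, (+ 1 / length xs)} xs)

  insertions-map : ∀ x xs → insertions (f x) (map f xs) ≡ map (map f) (insertions x xs)
  insertions-map x []       = refl
  insertions-map x (y ∷ ys) = cong ((f x ∷ f y ∷ map f ys) ∷_) (begin
    map (f y ∷_) (insertions (f x) (map f ys))   ≡⟨ cong (map (f y ∷_)) (insertions-map x ys) ⟩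
    map (f y ∷_) (map (map f) (insertions x ys)) ≡⟨ map-∘ {g = f y ∷_} {f = map f} (insertions x ys) ⟨
    map (map f ∘ (y ∷_)) (insertions x ys)       ≡⟨ map-∘ {g = map f} {f = y ∷_} (insertions x ys) ⟩
    map (map f) (map (y ∷_) (insertions x ys))   ∎)
    where open ≡-Reasoning

  permutations-map : ∀ xs → permutations (map f xs) ≡ map (map f) (permutations xs)
  permutations-map []       = refl
  permutations-map (x ∷ xs) = begin
    concatMap (insertions (f x)) (permutations (map f xs))       ≡⟨ cong (concatMap (insertions (f x))) (permutations-map xs) ⟩
    concatMap (insertions (f x)) (map (map f) (permutations xs)) ≡⟨ concatMap-map _ (map f) (permutations xs) ⟩
    concatMap (insertions (f x) ∘ map f) (permutations xs)       ≡⟨ concatMap-cong (insertions-map x) (permutations xs) ⟩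
    concatMap (map (map f) ∘ insertions x) (permutations xs)     ≡⟨ map-concatMap (map f) (insertions x) (permutations xs) ⟨
    map (map f) (concatMap (insertions x) (permutations xs))     ∎
    where open ≡-Reasoning

  filter-map : ∀ {P : U.Pred B 0ℓ} (P? : U.Decidable P) xs →
               filter P? (map f xs) ≡ map f (filter (λ x → P? (f x)) xs)
  filter-map P? []       = refl
  filter-map P? (x ∷ xs) with does (P? (f x))
  ... | false = filter-map P? xs
  ... | true  = cong (f x ∷_) (filter-map P? xs)

module _ (f : A → B) where

  total-map : ∀ xs → total (map (map₁ f) xs) ≡ total xs
  total-map xs = cong sum (sym (map-∘ xs))

  locate-map : ∀ D xs t → locate D (map (map₁ f) xs) t ≡ Maybe.map f (locate D xs t)
  locate-map D []             t = refl
  locate-map D ((x , d) ∷ xs) t with does (D ≤? t ×-dec t <? D ℕ.+ d)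
  ... | true  = refl
  ... | false = locate-map (D ℕ.+ d) xs t

  module _ (m : ℕ) .{{_ : ℕ.NonZero m}} where

    systematicSample-map : ∀ xs r →
      systematicSample m (map (map₁ f) xs) r ≡ map f (systematicSample m xs r)
    systematicSample-map xs r rewrite total-map xs = trans
      (mapMaybe-cong (λ j → locate-map 0 xs (r ℕ.+ j * (total xs ℕ./ m))) (upTo m))
      (sym (map-mapMaybe f _ (upTo m)))

    -- The elements are mere labels in random systematic sampling: the permutations act on
    -- positions, and the step, the offset and the located index depend only on the frequencies.
    rss-map : ∀ xs → rss m (map (map₁ f) xs) ≡ map (map₁ (map f)) (rss m xs)
    rss-map xs rewrite total-map xs = begin
      (uniform (permutations (map f′ xs)) >>= sample)
        ≡⟨ cong (λ σs → uniform σs >>= sample) (permutations-map f′ xs) ⟩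
      (uniform (map (map f′) (permutations xs)) >>= sample)
        ≡⟨ cong (_>>= sample) (uniform-map (map f′) (permutations xs)) ⟩
      (map (map₁ (map f′)) (uniform (permutations xs)) >>= sample)
        ≡⟨ >>=-mapˡ sample (map f′) (uniform (permutations xs)) ⟩
      (uniform (permutations xs) >>= sample ∘ map f′)
        ≡⟨ >>=-congʳ sample-map (uniform (permutations xs)) ⟩
      (uniform (permutations xs) >>= map (map₁ (map f)) ∘ sample)
        ≡⟨ map->>= (map f) sample (uniform (permutations xs)) ⟨
      map (map₁ (map f)) (uniform (permutations xs) >>= sample)
        ∎
      where
      open ≡-Reasoning
      f′ = map₁ f

      -- Polymorphic in the label type, with the offset range fixed by `xs`, so that one function
      -- samples from both the original and the relabelled permutations.
      sample : ∀ {X} → Bag X → Dist (List X)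
      sample σ = uniform (upTo (total xs ℕ./ m)) >>= λ r → return (systematicSample m σ r)

      sample-map : ∀ σ → sample (map f′ σ) ≡ map (map₁ (map f)) (sample σ)
      sample-map σ = trans
        (>>=-congʳ (λ r → cong return (systematicSample-map σ r)) (uniform (upTo (total xs ℕ./ m))))
        (sym (map->>= (map f) (return ∘ systematicSample m σ) (uniform (upTo (total xs ℕ./ m)))))

module _ {f : Fin k → Fin n} (f-inj : Injective _≡_ _≡_ f) where

  -- Deduplication compares vertices, and by injectivity `f x ≡ f y` holds exactly when `x ≡ y`, so
  -- the same entries are removed before and after relabelling.
  deduplicate-map : ∀ xs →
    deduplicate Fin._≟_ (map f xs) ≡ map f (deduplicate Fin._≟_ xs)
  deduplicate-map []       = refl
  deduplicate-map (x ∷ xs) = cong (f x ∷_) (begin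
    filter (¬? ∘ (f x Fin.≟_)) (deduplicate Fin._≟_ (map f xs))   ≡⟨ cong (filter _) (deduplicate-map xs) ⟩
    filter (¬? ∘ (f x Fin.≟_)) (map f (deduplicate Fin._≟_ xs))   ≡⟨ filter-map f _ (deduplicate Fin._≟_ xs) ⟩
    map f (filter (λ y → ¬? (f x Fin.≟ f y)) (deduplicate Fin._≟_ xs))
      ≡⟨ cong (map f) (filter-≐ _ _ ((_∘ cong f) , (_∘ f-inj)) (deduplicate Fin._≟_ xs)) ⟩
    map f (filter (¬? ∘ (x Fin.≟_)) (deduplicate Fin._≟_ xs))     ∎)
    where open ≡-Reasoning

  endpointBag-map : ∀ es → endpointBag (map (×.map f f) es) ≡ map (map₁ f) (endpointBag es)
  endpointBag-map es = begin
    map frequency′ (deduplicate Fin._≟_ (concatMap _ (map (×.map f f) es)))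
      ≡⟨ cong (map frequency′ ∘ deduplicate Fin._≟_)
              (trans (concatMap-map _ (×.map f f) es) (sym (map-concatMap f _ es))) ⟩
    map frequency′ (deduplicate Fin._≟_ (map f vs))
      ≡⟨ cong (map frequency′) (deduplicate-map vs) ⟩
    map frequency′ (map f (deduplicate Fin._≟_ vs))
      ≡⟨ map-∘ {g = frequency′} {f = f} (deduplicate Fin._≟_ vs) ⟨
    map (frequency′ ∘ f) (deduplicate Fin._≟_ vs)
      ≡⟨ map-cong (λ v → cong (f v ,_) (count-map v)) (deduplicate Fin._≟_ vs) ⟩
    map (λ v → f v , length (filter (endpoint? v) es)) (deduplicate Fin._≟_ vs)
      ≡⟨ map-∘ {g = map₁ f} (deduplicate Fin._≟_ vs) ⟩
    map (map₁ f) (endpointBag es)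
      ∎
    where
    open ≡-Reasoning
    vs         = concatMap (λ (a , b) → a ∷ b ∷ []) es
    frequency′ = λ v → v , length (filter (endpoint? v) (map (×.map f f) es))

    count-map : ∀ v → length (filter (endpoint? (f v)) (map (×.map f f) es)) ≡
                      length (filter (endpoint? v) es)
    count-map v = begin
      length (filter (endpoint? (f v)) (map (×.map f f) es))
        ≡⟨ cong length (filter-map (×.map f f) (endpoint? (f v)) es) ⟩
      length (map (×.map f f) (filter (λ e → endpoint? (f v) (×.map f f e)) es))
        ≡⟨ length-map (×.map f f) (filter (λ e → endpoint? (f v) (×.map f f e)) es) ⟩
      length (filter (λ e → endpoint? (f v) (×.map f f e)) es)
        ≡⟨ cong length (filter-≐ _ _ (⊎.map f-inj f-inj , ⊎.map (cong f) (cong f)) es) ⟩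
      length (filter (endpoint? v) es)
        ∎

-- Selection probability given the drawn edges

pairProbability : Fin n → Fin n → List (Fin n × Fin n) → ℚ
pairProbability u w es = Pr (isPair? u w) (rss 2 (endpointBag es))

-- Relabelling commutes with forming the bag and with sampling; since `map f` is injective on lists,
-- a relabelled sample is the relabelled pair exactly when the original sample is the original pair.
pairProbability-map : ∀ {f : Fin k → Fin n} → Injective _≡_ _≡_ f → ∀ i j es →
  pairProbability (f i) (f j) (map (×.map f f) es) ≡ pairProbability i j es
pairProbability-map {f = f} f-inj i j es = begin
  Pr isPair′? (rss 2 (endpointBag (map (×.map f f) es)))  ≡⟨ cong (Pr isPair′? ∘ rss 2) (endpointBag-map f-inj es) ⟩
  Pr isPair′? (rss 2 (map (map₁ f) bag))                  ≡⟨ cong (Pr isPair′?) (rss-map f 2 bag) ⟩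
  Pr isPair′? (map (map₁ (map f)) (rss 2 bag))            ≡⟨ Pr-map isPair′? (map f) (rss 2 bag) ⟩
  Pr (λ s → isPair′? (map f s)) (rss 2 bag)
    ≡⟨ Pr-cong _ (isPair? i j) (⊎.map f*-inj f*-inj , ⊎.map (cong (map f)) (cong (map f))) (rss 2 bag) ⟩
  Pr (isPair? i j) (rss 2 bag)                            ∎
  where
  open ≡-Reasoning
  bag       = endpointBag es
  isPair′?  = isPair? (f i) (f j)
  f*-inj : Injective _≡_ _≡_ (map f)
  f*-inj = map-injective f-inj

-- Both orientations are allowed because `edges` lists the smaller endpoint first, whatever role
-- that endpoint plays in the argument.
_Joins_⟷_ : Fin n × Fin n → Fin n → Fin n → Set
e Joins u ⟷ v = e ≡ (u , v) ⊎ e ≡ (v , u)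

-- The endpoints are relabelled by Fin 2 or Fin 4, where the probability is
-- found by evaluation.

double-edge : ∀ {u w : Fin n} {e} → u ≢ w → e Joins u ⟷ w →
              pairProbability u w (e ∷ e ∷ []) ≡ 1ℚ
double-edge {u = u} {w} u≢w = λ where
    -- Both vertices have frequency 2 and the step is 2, so the positions `r` and `r + 2` always hit
    -- different vertices.
    (inj₁ refl) → pairProbability-map f-inj 0F 1F ((0F , 1F) ∷ (0F , 1F) ∷ [])
    (inj₂ refl) → pairProbability-map f-inj 0F 1F ((1F , 0F) ∷ (1F , 0F) ∷ [])
  where
  f-inj : Injective _≡_ _≡_ (Vec.lookup (u ∷ w ∷ []))
  f-inj = Vec.lookup-injective ((u≢w ∷ []) ∷ [] ∷ []) _ _

-- Four vertices of frequency 1 give step 2, so the sample consists of the entries at positions `r`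
-- and `r + 2` of a random permutation: each of the six pairs is equally likely. Both draw orders
-- are treated because the bag depends on the order.
disjoint-edges : ∀ {u c w d : Fin n} {e e′} → Vec.Unique (u ∷ c ∷ w ∷ d ∷ []) →
  e Joins u ⟷ c → e′ Joins w ⟷ d →
  pairProbability u w (e ∷ e′ ∷ []) ≡ + 1 / 6 × pairProbability u w (e′ ∷ e ∷ []) ≡ + 1 / 6
disjoint-edges {u = u} {c} {w} {d} distinct = λ where
    (inj₁ refl) (inj₁ refl) → both (0F , 1F) (2F , 3F)
    (inj₁ refl) (inj₂ refl) → both (0F , 1F) (3F , 2F)
    (inj₂ refl) (inj₁ refl) → both (1F , 0F) (2F , 3F)
    (inj₂ refl) (inj₂ refl) → both (1F , 0F) (3F , 2F)
  where
  f = Vec.lookup (u ∷ c ∷ w ∷ d ∷ [])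
  f-inj : Injective _≡_ _≡_ f
  f-inj = Vec.lookup-injective distinct _ _
  both : ∀ e e′ →
    pairProbability u w (map (×.map f f) (e ∷ e′ ∷ [])) ≡ pairProbability 0F 2F (e ∷ e′ ∷ []) ×
    pairProbability u w (map (×.map f f) (e′ ∷ e ∷ [])) ≡ pairProbability 0F 2F (e′ ∷ e ∷ [])
  both e e′ = pairProbability-map f-inj 0F 2F (e ∷ e′ ∷ []) ,
              pairProbability-map f-inj 0F 2F (e′ ∷ e ∷ [])

-- Graphs of minimum degree 2

two-members : ∀ {xs : List A} → Unique xs → 2 ℕ.≤ length xs →
              ∃₂ λ x y → x ∈ xs × y ∈ xs × x ≢ y
two-members ((x≢y ∷ _) ∷ _) (s≤s (s≤s _)) = _ , _ , here refl , there (here refl) , x≢y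

-- If the edges were equal, their ends would match either straight or crosswise, depending on the
-- two orientations.
joins-≢ : ∀ {u v u′ v′ : Fin n} {e e′} → e Joins u ⟷ v → e′ Joins u′ ⟷ v′ →
          ¬ (u ≡ u′ × v ≡ v′) → ¬ (u ≡ v′ × v ≡ u′) → e ≢ e′
joins-≢ (inj₁ refl) (inj₁ refl) same cross refl = same (refl , refl)
joins-≢ (inj₁ refl) (inj₂ refl) same cross refl = cross (refl , refl)
joins-≢ (inj₂ refl) (inj₁ refl) same cross refl = cross (refl , refl)
joins-≢ (inj₂ refl) (inj₂ refl) same cross refl = same (refl , refl)

module _ (G : SimpleGraph n) where
  open SimpleGraph G renaming (sym to ~-sym)

  ∈-edges : ∀ {i j} → i Fin.< j → i ~ j → (i , j) ∈ edges
  ∈-edges {i} {j} i<j i~j = ∈-filter⁺ (λ (i , j) → i Fin.<? j ×-dec i ~? j)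
    (∈-cartesianProduct⁺ (∈-allFin i) (∈-allFin j)) (i<j , i~j)

  edge-joining : ∀ {u v} → u ~ v → ∃ λ e → e ∈ edges × e Joins u ⟷ v
  edge-joining {u} {v} u~v with Fin.<-cmp u v
  ... | tri< u<v _ _ = _ , ∈-edges u<v u~v , inj₁ refl
  ... | tri≈ _ u≡v _ = contradiction u~v (irrefl u≡v)
  ... | tri> _ _ v<u = _ , ∈-edges v<u (~-sym u~v) , inj₂ refl

  two-neighbours : MinDegree≥2 G → ∀ v → ∃₂ λ c c′ → v ~ c × v ~ c′ × c ≢ c′
  two-neighbours δ≥2 v with two-members (Unique.filter⁺ (v ~?_) (Unique.allFin⁺ n)) (δ≥2 v)
  ... | c , c′ , c∈ , c′∈ , c≢c′ = c , c′ , neighbour c∈ , neighbour c′∈ , c≢c′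
    where
    neighbour : ∀ {x} → x ∈ filter (v ~?_) (allFin n) → v ~ x
    neighbour x∈ = proj₂ (∈-filter⁻ (v ~?_) {xs = allFin n} x∈)

  -- Edges to be drawn together are `uc` with `wd` and `uc′` with `wd′`, so only these pairs of
  -- neighbours must differ. The equalities `c ≡ d′` and `c′ ≡ d` remain possible, as for opposite
  -- vertices of a 4-cycle.
  record Matching (u w : Fin n) : Set where
    field
      {c c′ d d′} : Fin n
      u~c   : u ~ c
      u~c′  : u ~ c′
      w~d   : w ~ d
      w~d′  : w ~ d′
      c≢c′  : c ≢ c′
      d≢d′  : d ≢ d′
      c≢d   : c ≢ d
      c′≢d′ : c′ ≢ d′

  matching : MinDegree≥2 G → ∀ u w → Matching u w
  matching δ≥2 u w with two-neighbours δ≥2 u | two-neighbours δ≥2 w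
  ... | c , c′ , u~c , u~c′ , c≢c′ | d , d′ , w~d , w~d′ , d≢d′ with c Fin.≟ d | c′ Fin.≟ d′
  ... | no c≢d | no c′≢d′ = record
    { u~c = u~c ; u~c′ = u~c′ ; w~d = w~d ; w~d′ = w~d′
    ; c≢c′ = c≢c′ ; d≢d′ = d≢d′ ; c≢d = c≢d ; c′≢d′ = c′≢d′ }
  -- Either collision is repaired by exchanging `d` and `d′`: if `c ≡ d`, then `c` differs from `d′`
  -- and `c′` differs from `d`; the case `c′ ≡ d′` is symmetric.
  ... | yes refl | _ = record
    { u~c = u~c ; u~c′ = u~c′ ; w~d = w~d′ ; w~d′ = w~d
    ; c≢c′ = c≢c′ ; d≢d′ = d≢d′ ∘ sym ; c≢d = d≢d′ ; c′≢d′ = c≢c′ ∘ sym }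
  ... | no _ | yes refl = record
    { u~c = u~c ; u~c′ = u~c′ ; w~d = w~d′ ; w~d′ = w~d
    ; c≢c′ = c≢c′ ; d≢d′ = d≢d′ ∘ sym ; c≢d = c≢c′ ; c′≢d′ = d≢d′ ∘ sym }

  -- Each first draw in `es` is given one good second draw, and each such ordered draw has weight
  -- `1 / ∣E∣` squared. The nested product mirrors the two successive uses of `Pr-uniform-≥`.
  π-≥ : ∀ {u w q es} .{{_ : ℕ.NonZero ∣E∣}} → Unique es → es ⊆ edges →
        All (λ e → ∃ λ e′ → e′ ∈ edges × q ℚ.≤ pairProbability u w (e ∷ e′ ∷ [])) es →
        (+ length es / ∣E∣) ℚ.* ((+ 1 / ∣E∣) ℚ.* q) ℚ.≤ π G u w
  π-≥ {u} {w} {q} es! es⊆ second = Pr-uniform-≥ (isPair? u w) {f = drawSecond}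
    (λ e → >>=-nonNeg (uniform-nonNeg edges) (sample-nonNeg e)) es! es⊆ (All.map (λ {e} → second-≥ e) second)
    where
    sample : Fin n × Fin n → Fin n × Fin n → Dist (List (Fin n))
    sample e e′ = rss 2 (endpointBag (e ∷ e′ ∷ []))

    sample-nonNeg : ∀ e e′ → All (NonNegative ∘ proj₂) (sample e e′)
    sample-nonNeg e e′ = rss-nonNeg 2 (endpointBag (e ∷ e′ ∷ []))

    drawSecond : Fin n × Fin n → Dist (List (Fin n))
    drawSecond e = uniform edges >>= sample e

    second-≥ : ∀ e → (∃ λ e′ → e′ ∈ edges × q ℚ.≤ pairProbability u w (e ∷ e′ ∷ [])) →
               (+ 1 / ∣E∣) ℚ.* q ℚ.≤ Pr (isPair? u w) (drawSecond e)
    second-≥ e (e′ , e′∈ , q≤) = Pr-uniform-≥ (isPair? u w) {f = sample e} (sample-nonNeg e)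
      {ys = e′ ∷ []} ([] ∷ []) (λ { (here refl) → e′∈ }) (q≤ ∷ [])

  -- Bounds for adjacent and for non-adjacent pairs

  module _ {u w : Fin n} (u≢w : u ≢ w) .{{_ : ℕ.NonZero ∣E∣}} where

    adjacent : u ~ w → (+ 1 / ∣E∣) ℚ.* ((+ 1 / ∣E∣) ℚ.* 1ℚ) ℚ.≤ π G u w
    adjacent u~w with edge-joining u~w
    ... | e , e∈ , e-uw = π-≥ {q = 1ℚ} ([] ∷ []) (λ { (here refl) → e∈ })
      ((e , e∈ , ℚ.≤-reflexive (sym (double-edge u≢w e-uw))) ∷ [])

    nonadjacent : ¬ u ~ w → Matching u w →
                  (+ 4 / ∣E∣) ℚ.* ((+ 1 / ∣E∣) ℚ.* (+ 1 / 6)) ℚ.≤ π G u w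
    nonadjacent u≁w M
      with edge-joining (Matching.u~c M) | edge-joining (Matching.u~c′ M)
         | edge-joining (Matching.w~d M) | edge-joining (Matching.w~d′ M)
    ... | e , e∈ , e-uc | e′ , e′∈ , e′-uc′ | f , f∈ , f-wd | f′ , f′∈ , f′-wd′ =
      π-≥ {q = + 1 / 6} distinct (All.lookup (e∈ ∷ e′∈ ∷ f∈ ∷ f′∈ ∷ []))
        -- The partnership is an involution, `e` with `f` and `e′` with `f′`, so all four edges
        -- serve as first draws.
        ( (f  , f∈  , ≥1/6 (proj₁ (disjoint u~c  w~d  c≢d   e-uc   f-wd)))
        ∷ (f′ , f′∈ , ≥1/6 (proj₁ (disjoint u~c′ w~d′ c′≢d′ e′-uc′ f′-wd′)))
        ∷ (e  , e∈  , ≥1/6 (proj₂ (disjoint u~c  w~d  c≢d   e-uc   f-wd)))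
        ∷ (e′ , e′∈ , ≥1/6 (proj₂ (disjoint u~c′ w~d′ c′≢d′ e′-uc′ f′-wd′)))
        ∷ [])
      where
      open Matching M

      ≥1/6 : ∀ {p} → p ≡ + 1 / 6 → + 1 / 6 ℚ.≤ p
      ≥1/6 = ℚ.≤-reflexive ∘ sym

      ~⇒≢ : ∀ {x y} → x ~ y → x ≢ y
      ~⇒≢ x~y x≡y = irrefl x≡y x~y

      disjoint : ∀ {x y e f} → u ~ x → w ~ y → x ≢ y → e Joins u ⟷ x → f Joins w ⟷ y →
        pairProbability u w (e ∷ f ∷ []) ≡ + 1 / 6 × pairProbability u w (f ∷ e ∷ []) ≡ + 1 / 6
      -- Non-adjacency excludes `u ≡ y` and `x ≡ w`; the remaining inequalities come from
      -- irreflexivity, `u≢w` and `x≢y`.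
      disjoint u~x w~y x≢y = disjoint-edges
        ( (~⇒≢ u~x ∷ u≢w ∷ (λ { refl → u≁w (~-sym w~y) }) ∷ [])
        ∷ ((λ { refl → u≁w u~x }) ∷ x≢y ∷ [])
        ∷ (~⇒≢ w~y ∷ [])
        ∷ []
        ∷ [])

      same-hub : ∀ {v x y e f} → v ~ y → x ≢ y → e Joins v ⟷ x → f Joins v ⟷ y → e ≢ f
      same-hub v~y x≢y e-vx f-vy =
        joins-≢ e-vx f-vy (x≢y ∘ proj₂) (λ (v≡y , _) → irrefl v≡y v~y)

      -- A straight match would give `u ≡ w`, a crosswise one `u ≡ y` and hence `w ~ u`. This covers
      -- a common neighbour `x ≡ y` as well.
      other-hub : ∀ {x y e f} → w ~ y → e Joins u ⟷ x → f Joins w ⟷ y → e ≢ f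
      other-hub w~y e-ux f-wy =
        joins-≢ e-ux f-wy (u≢w ∘ proj₁) (λ { (refl , _) → u≁w (~-sym w~y) })

      distinct : Unique (e ∷ e′ ∷ f ∷ f′ ∷ [])
      distinct =
          (same-hub u~c′ c≢c′ e-uc e′-uc′ ∷ other-hub w~d e-uc f-wd ∷ other-hub w~d′ e-uc f′-wd′ ∷ [])
        ∷ (other-hub w~d e′-uc′ f-wd ∷ other-hub w~d′ e′-uc′ f′-wd′ ∷ [])
        ∷ (same-hub w~d′ d≢d′ f-wd f′-wd′ ∷ [])
        ∷ [] ∷ []

-- Comparison with the bound 2/(3|E|²)

nonadjacent-bound : ∀ N .{{_ : ℕ.NonZero N}} .{{_ : ℕ.NonZero (3 * N ^ 2)}} →
  + 2 / (3 * N ^ 2) ≡ (+ 4 / N) ℚ.* ((+ 1 / N) ℚ.* (+ 1 / 6))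
nonadjacent-bound N@(suc _) = sym (begin
  (+ 4 / N) ℚ.* ((+ 1 / N) ℚ.* (+ 1 / 6)) ≡⟨ cong ((+ 4 / N) ℚ.*_) (/-* 1 N 1 6) ⟩
  (+ 4 / N) ℚ.* (+ 1 / (N * 6))           ≡⟨ /-* 4 N 1 (N * 6) ⟩
  -- The constant 2/3 of the theorem is four draws times 1/6, so this case meets the bound with
  -- equality.
  + 4 / (N * (N * 6))                     ≡⟨ /-cong-≃ 4 (N * (N * 6)) 2 (3 * N ^ 2) (cross N) ⟩
  + 2 / (3 * N ^ 2)                       ∎)
  where
  open ≡-Reasoning
  open Data.Nat.Solver.+-*-Solver
  cross : ∀ N → 4 * (3 * N ^ 2) ≡ 2 * (N * (N * 6))
  cross = solve 1 (λ N → con 4 :* (con 3 :* N :^ 2) := con 2 :* (N :* (N :* con 6))) refl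

-- The bound is rewritten as `1 / N` times `1 / N` times `2 / 3`, which leaves only the comparison
-- of `2 / 3` with 1.
adjacent-bound : ∀ N .{{_ : ℕ.NonZero N}} .{{_ : ℕ.NonZero (3 * N ^ 2)}} →
  + 2 / (3 * N ^ 2) ℚ.≤ (+ 1 / N) ℚ.* ((+ 1 / N) ℚ.* 1ℚ)
adjacent-bound N@(suc _) = begin
  + 2 / (3 * N ^ 2)                       ≡⟨ /-cong-≃ 2 (3 * N ^ 2) 2 (N * (N * 3)) (cross N) ⟩
  + 2 / (N * (N * 3))                     ≡⟨ /-* 1 N 2 (N * 3) ⟨
  (+ 1 / N) ℚ.* (+ 2 / (N * 3))           ≡⟨ cong ((+ 1 / N) ℚ.*_) (/-* 1 N 2 3) ⟨
  (+ 1 / N) ℚ.* ((+ 1 / N) ℚ.* (+ 2 / 3)) ≤⟨ 1/N*-mono (1/N*-mono 2/3≤1) ⟩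
  (+ 1 / N) ℚ.* ((+ 1 / N) ℚ.* 1ℚ)        ∎
  where
  open ℚ.≤-Reasoning
  open Data.Nat.Solver.+-*-Solver
  cross : ∀ N → 2 * (N * (N * 3)) ≡ 2 * (3 * N ^ 2)
  cross = solve 1 (λ N → con 2 :* (N :* (N :* con 3)) := con 2 :* (con 3 :* N :^ 2)) refl

  1/N*-mono : ∀ {p q} → p ℚ.≤ q → (+ 1 / N) ℚ.* p ℚ.≤ (+ 1 / N) ℚ.* q
  1/N*-mono = ℚ.*-monoˡ-≤-nonNeg (+ 1 / N) {{ℚ.normalize-nonNeg 1 N}}

  2/3≤1 : + 2 / 3 ℚ.≤ 1ℚ
  2/3≤1 = ℚ.*≤* (ℤ.+≤+ (s≤s (s≤s ℕ.z≤n)))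

theorem9 : ∀ {n : ℕ} (G : SimpleGraph n) (δ≥2 : MinDegree≥2 G) (u w : Fin n) → u ≢ w →
    π G u w ≥ _/_ (+ 2) (3 * SimpleGraph.∣E∣ G ^ 2) {{3∣E∣²≢0 G δ≥2 u}}
theorem9 G δ≥2 u w u≢w = [ bound-adjacent , bound-nonadjacent ]′ (toSum (u ~? w))
  where
  open SimpleGraph G
  -- The vertex `u` has a neighbour by the degree condition, so there is an edge and the
  -- denominators are nonzero.
  instance
    _ = ∣E∣≢0 G δ≥2 u
    _ = 3∣E∣²≢0 G δ≥2 u

  bound-adjacent : u ~ w → + 2 / (3 * ∣E∣ ^ 2) ℚ.≤ π G u w
  bound-adjacent u~w = ℚ.≤-trans (adjacent-bound ∣E∣) (adjacent G u≢w u~w)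

  bound-nonadjacent : ¬ u ~ w → + 2 / (3 * ∣E∣ ^ 2) ℚ.≤ π G u w
  bound-nonadjacent u≁w = ℚ.≤-trans (ℚ.≤-reflexive (nonadjacent-bound ∣E∣))
                                    (nonadjacent G u≢w u≁w (matching G δ≥2 u w))
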